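{- Let $R$ be a binary relation on a set $A$. If $\mathbf{WN}(R)$, $\mathbf{UN}^{=}(R)$ and $\mathbf{RP}(R)$ hold, then there is no $R$-increasing sequence, i.e. for every $s:\mathbb{N}\to A$ it is not the case that $s(k)\to s(k+1)$ for all $k$. (Constructively.)
   Context: Work in constructive (intuitionistic) logic / Martin-Löf type theory without excluded middle or other axioms. Let $R$ be a binary relation on $A$; write $a\to b$ for $R\,a\,b$, $\to^*$ for its reflexive–transitive closure, $=_R$ for the equivalence relation generated by $R$, $\equiv$ for identity. $a\in\mathrm{NF}$ iff there is no $b$ with $a\to b$. $\mathbf{WN}(R)$: every $a$ has some $b\in\mathrm{NF}$ with $a\to^* b$. $\mathbf{UN}^{=}(R)$: for all $a,b\in\mathrm{NF}$, $a=_R b$ implies $a\equiv b$. A sequence $s:\mathbb{N}\to A$ is $R$-increasing if $s(k)\to s(k+1)$ for all $k$; it is bounded if there is $b$ with $s(i)\to^* b$ for all $i$. $\mathbf{RP}(R)$: for every bounded $R$-increasing sequence $s$ there is $i$ such that for all $x\in A$, $s(i)\to^* x$ implies $x\to^* s(i)$. -}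

module Defs where

open import Data.Nat.Base using (ℕ; suc)
open import Data.Product.Base using (∃-syntax)
open import Level using (Level; _⊔_)
open import Relation.Binary.Core using (Rel)
open import Relation.Binary.Construct.Closure.ReflexiveTransitive using (Star)

module _ {a ℓ : Level} {A : Set a} (R : Rel A ℓ) where

  Increasing : (ℕ → A) → Set ℓ
  Increasing s = ∀ k → R (s k) (s (suc k))

  Bounded : (ℕ → A) → Set (a ⊔ ℓ)
  Bounded s = ∃[ b ] (∀ i → Star R (s i) b)

  RP : Set (a ⊔ ℓ)
  RP = ∀ (s : ℕ → A) → Increasing s → Bounded s →
       ∃[ i ] (∀ x → Star R (s i) x → Star R x (s i))

{-# OPTIONS --safe #-}
-- Weak normalization and unique normal forms give confluence, so the normal
-- form n of s 0 is a normal form of every s i; in particular n bounds s.  At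
-- the index i supplied by RP we get n ↠ s i, so s i is itself normal, which
-- contradicts s i ⟶ s (suc i).
module Submission where

open import Defs
open import Data.Nat.Base using (ℕ; zero; suc)
open import Data.Product.Base using (_,_)
open import Level using (Level)
open import Relation.Binary.Core using (Rel)
open import Relation.Binary.Construct.Closure.Equivalence.Properties using (a—↠b&a—↠c⇒b↔c)
open import Relation.Binary.Construct.Closure.ReflexiveTransitive using (Star; ε; _◅_; _◅◅_)
open import Relation.Binary.Rewriting using (IsNormalForm; WeaklyNormalizing; UniqueNormalForm; conf⇒nf; un&wn⇒cr)
open import Relation.Nullary.Negation.Core using (¬_)

module _ {a ℓ : Level} {A : Set a} {R : Rel A ℓ} where

  increasing⇒0↠ : ∀ {s} → Increasing R s → ∀ i → Star R (s zero) (s i)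
  increasing⇒0↠ inc zero    = ε
  increasing⇒0↠ inc (suc i) = increasing⇒0↠ inc i ◅◅ inc i ◅ ε

  -- A reduction out of a normal form must be empty, since its first step would already refute
  -- normality.
  nf-↠⇒nf : ∀ {x y} → IsNormalForm R x → Star R x y → IsNormalForm R y
  nf-↠⇒nf x-nf ε         = x-nf
  nf-↠⇒nf x-nf (r ◅ _) _ = x-nf (_ , r)

theorem1p2p3 : ∀ {a ℓ : Level} {A : Set a} (R : Rel A ℓ) →
    WeaklyNormalizing R → UniqueNormalForm R → RP R →
    ∀ (s : ℕ → A) → ¬ Increasing R s
theorem1p2p3 R wn un rp s inc =
  let n , n-nf , s₀↠n = wn (s zero)
      -- `s i` and `n` are both reducts of `s zero`, hence convertible; confluence turns
      -- convertibility to a normal form into a reduction.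
      s↠n = λ i → conf⇒nf (un&wn⇒cr un wn) n-nf
                    (a—↠b&a—↠c⇒b↔c (increasing⇒0↠ inc i) s₀↠n)
      i , sᵢ-recurrent = rp s inc (n , s↠n)
  -- Recurrence, taken at the reduct `n` of `s i`, reverses `s↠n i`.
  in nf-↠⇒nf n-nf (sᵢ-recurrent n (s↠n i)) (_ , inc i)
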